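{- For integers $k \geq 1$ and $n \geq 0$ let $f_k(n)$ denote the number of abelian squares of length $2n$ over an alphabet with $k$ letters. Then for all integers $k_1, k_2 \geq 1$ and $n \geq 0$, $$ f_{k_1+k_2}(n) = \sum_{0 \leq i \leq n} \binom{n}{i}^2 f_{k_1}(i) \, f_{k_2}(n-i). $$
   Context: An abelian square of length $2n$ is a string of the form $x x'$ where $|x| = |x'| = n$ and $x'$ is a permutation (rearrangement) of the symbols of $x$; equivalently, every letter of the alphabet occurs the same number of times in $x$ as in $x'$. The quantity $f_k(n)$ is the number of such strings over the alphabet $\{1, 2, \ldots, k\}$. By convention $f_k(0) = 1$ (the empty string is counted when $n = 0$). -}

module Defs where

open import Data.Fin.Base using (Fin)
import Data.Fin.Properties as Fin
open import Data.List.Base as List using (List; []; _∷_; [_]; allFin; cartesianProductWith; filter; length)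
open import Data.List.Membership.DecPropositional using (_∈?_)
open import Data.List.Membership.Propositional using (_∈_)
open import Data.List.Membership.Propositional.Properties using (∈-∃++; ∈-allFin; ∈-cartesianProductWith⁺)
open import Data.List.Relation.Binary.Permutation.Propositional using (_↭_; ↭-refl; ↭-trans; ↭-sym; ↭-prep)
open import Data.List.Relation.Binary.Permutation.Propositional.Properties using (¬x∷xs↭[]; ∈-resp-↭; drop-mid; shift)
open import Data.List.Relation.Unary.Any using (here)
open import Data.List.Relation.Unary.Unique.Propositional using (Unique; []; _∷_)
import Data.List.Relation.Unary.Unique.Propositional.Properties as Unique
open import Data.List.Relation.Unary.All using ([])
open import Data.Nat.Base using (ℕ; zero; suc; _+_)
open import Data.Product.Base using (∃₂; _×_; _,_)
open import Data.Vec.Base as Vec using (Vec; []; _∷_; _++_; toList)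
open import Data.Vec.Properties using (++-injective; ∷-injective)
open import Relation.Binary.Definitions using (DecidableEquality; Decidable)
open import Relation.Binary.PropositionalEquality using (_≡_; refl)
open import Relation.Nullary using (Dec; yes; no)
open import Relation.Nullary.Decidable using (map′)

module _ {A : Set} where

  IsAbelianSquare : ∀ n → Vec A (n + n) → Set
  IsAbelianSquare n w = ∃₂ λ (x x′ : Vec A n) → w ≡ x ++ x′ × toList x ↭ toList x′

  module _ (_≟_ : DecidableEquality A) where

    permutation? : Decidable {A = List A} _↭_
    permutation? []       []       = yes ↭-refl
    permutation? []       (y ∷ ys) = no λ p → ¬x∷xs↭[] (↭-sym p)
    permutation? (x ∷ xs) ys with _∈?_ _≟_ x ys
    ... | no x∉ys = no λ p → x∉ys (∈-resp-↭ p (here refl))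
    ... | yes x∈ys with us , vs , refl ← ∈-∃++ x∈ys =
      map′ (λ p → ↭-trans (↭-prep x p) (↭-sym (shift x us vs)))
           (drop-mid [] us)
           (permutation? xs (us List.++ vs))

    isAbelianSquare? : ∀ n (w : Vec A (n + n)) → Dec (IsAbelianSquare n w)
    isAbelianSquare? n w with x , x′ , refl ← Vec.splitAt n w =
      map′ (λ p → x , x′ , refl , p) from (permutation? (toList x) (toList x′))
      where
      from : IsAbelianSquare n (x ++ x′) → toList x ↭ toList x′
      from (y , y′ , eq , p) with refl , refl ← ++-injective x y eq = p

words : ∀ k m → List (Vec (Fin k) m)
words k zero    = [ [] ]
words k (suc m) = cartesianProductWith _∷_ (allFin k) (words k m)

-- `words k m` lists every word exactly once, so that the length of a filtered
-- sublist is a cardinality.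
words-complete : ∀ k m (w : Vec (Fin k) m) → w ∈ words k m
words-complete k zero    []      = here refl
words-complete k (suc m) (a ∷ w) =
  ∈-cartesianProductWith⁺ _∷_ (∈-allFin a) (words-complete k m w)

words-unique : ∀ k m → Unique (words k m)
words-unique k zero    = [] ∷ []
words-unique k (suc m) =
  Unique.cartesianProductWith⁺ _∷_ ∷-injective (Unique.allFin⁺ k) (words-unique k m)

-- f k n is the number of abelian squares of length 2n over a k-letter alphabet.
f : ℕ → ℕ → ℕ
f k n = length (filter (isAbelianSquare? Fin._≟_ n) (words k (n + n)))

{-# OPTIONS --safe #-}
-- Split a word over k₁ + k₂ letters into its subword of letters below k₁ and its
-- subword of the remaining letters.  A pair of subwords of lengths i and n - i
-- comes from C(n,i) words, and two words are permutations of each other iff their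
-- subwords are, which forces the same i for both.  Hence one factor C(n,i) for each
-- half of the abelian square.
module Submission where

open import Defs
open import Data.Fin.Base using (toℕ)
open import Data.Nat.Base using (ℕ; _+_; _*_; _∸_; _^_; _≤_)
open import Data.Nat.Combinatorics using (_C_)
open import Data.Nat.Properties using (+-0-commutativeMonoid)
open import Algebra.Properties.CommutativeMonoid.Sum +-0-commutativeMonoid using (sum⁺-syntax)
open import Relation.Binary.PropositionalEquality using (_≡_)

open import Algebra.Properties.CommutativeMonoid.Sum +-0-commutativeMonoid
  using (sum; sum-syntax; sum-cong-≗; sum-remove; sum-init-last; sum-replicate-zero; ∑-comm; ∑-distrib-+)
open import Data.Bool.Base using (true; false; if_then_else_)
open import Data.Fin.Base using (Fin; zero; suc; _↑ˡ_; _↑ʳ_; fromℕ; inject₁; splitAt; join; punchIn)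
open import Data.Fin.Properties
  using (splitAt-↑ˡ; splitAt-↑ʳ; join-splitAt; punchInᵢ≢i; toℕ-injective; toℕ-fromℕ; toℕ-inject₁; toℕ≤pred[n])
  renaming (_≟_ to _≟ᶠ_)
open import Data.List.Base
  using (List; []; _∷_; _++_; cartesianProductWith; filter; length; map; mapMaybe; tabulate)
open import Data.List.Properties using (filter-++; length-++; map-id; map-cong; map-∘)
open import Data.List.Relation.Binary.Permutation.Propositional
  using (_↭_; ↭-refl; ↭-prep; ↭-sym; ↭-trans)
open import Data.List.Relation.Binary.Permutation.Propositional.Properties
  using (++⁺; map⁺; mapMaybe-↭; shift; ↭-length)
open import Data.Nat.Base using (zero; suc)
open import Data.Nat.Combinatorics using (nCk+nC[k+1]≡[n+1]C[k+1]; k>n⇒nCk≡0)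
open import Data.Nat.Properties
  using (+-*-semiring; +-assoc; +-identityʳ; +-∸-assoc; *-identityˡ; *-zeroʳ; *-comm; *-distribʳ-+; n<1+n)
open import Algebra.Properties.Semiring.Sum +-*-semiring using (*-distribˡ-sum)
open import Data.Product.Base using (_×_; _,_)
open import Data.Sum.Base using (_⊎_; inj₁; inj₂)
open import Data.Sum using (isInj₁; isInj₂)
open import Data.Vec.Base as Vec using (Vec; []; _∷_; toList)
open import Data.Vec.Properties using (++-injective; length-toList)
open import Function.Base using (_∘_)
open import Function.Bundles using (_⇔_; mk⇔)
open import Relation.Binary.PropositionalEquality
  using (_≢_; _≗_; refl; sym; trans; cong; cong₂; subst₂; module ≡-Reasoning)
open import Relation.Nullary using (Dec; does; ¬_)
open import Relation.Nullary.Decidable using (_×-dec_; does-⇔; dec-false)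
open import Relation.Unary using (Pred; Decidable)
open import Data.Nat.Solver using (module +-*-Solver)

open ≡-Reasoning

-- Indicators

-- The Iverson bracket. It reads only `does`, so decision procedures for equivalent propositions
-- give the same number however they compute.
⟦_⟧ : ∀ {p} {P : Set p} → Dec P → ℕ
⟦ P? ⟧ = if does P? then 1 else 0

⟦⟧-⇔ : ∀ {p q} {P : Set p} {Q : Set q} → P ⇔ Q → (P? : Dec P) (Q? : Dec Q) → ⟦ P? ⟧ ≡ ⟦ Q? ⟧
⟦⟧-⇔ P⇔Q P? Q? = cong (if_then 1 else 0) (does-⇔ P⇔Q P? Q?)

⟦⟧-false : ∀ {p} {P : Set p} (P? : Dec P) → ¬ P → ⟦ P? ⟧ ≡ 0
⟦⟧-false P? ¬P = cong (if_then 1 else 0) (dec-false P? ¬P)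

⟦⟧-× : ∀ {p q} {P : Set p} {Q : Set q} (P? : Dec P) (Q? : Dec Q) → ⟦ P? ×-dec Q? ⟧ ≡ ⟦ P? ⟧ * ⟦ Q? ⟧
⟦⟧-× P? Q? with does P? | does Q?
... | true  | true  = refl
... | true  | false = refl
... | false | _     = refl

-- Finite sums

sum-zero : ∀ {n} (t : Fin n → ℕ) → (∀ i → t i ≡ 0) → sum t ≡ 0
sum-zero {n} t t≗0 = trans (sum-cong-≗ t≗0) (sum-replicate-zero n)

sum-single : ∀ {n} (t : Fin (suc n) → ℕ) i → (∀ j → j ≢ i → t j ≡ 0) → sum t ≡ t i
sum-single t i zero-off-i = begin
  sum t                        ≡⟨ sum-remove t ⟩
  t i + sum (t ∘ punchIn i)    ≡⟨ cong (t i +_) (sum-zero _ λ j → zero-off-i _ (punchInᵢ≢i i j)) ⟩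
  t i + 0                      ≡⟨ +-identityʳ (t i) ⟩
  t i                          ∎

sum-splitAt : ∀ m {n} (t : Fin (m + n) → ℕ) →
              sum t ≡ ∑[ i < m ] t (i ↑ˡ n) + ∑[ j < n ] t (m ↑ʳ j)
sum-splitAt zero    t = refl
sum-splitAt (suc m) t = trans (cong (t zero +_) (sum-splitAt m (t ∘ suc))) (sym (+-assoc (t zero) _ _))

sum-last-ℕ : ∀ n (F : ℕ → ℕ) → ∑[ i ≤ suc n ] F (toℕ i) ≡ ∑[ i ≤ n ] F (toℕ i) + F (suc n)
sum-last-ℕ n F = begin
  ∑[ i ≤ suc n ] F (toℕ i)
    ≡⟨ sum-init-last (F ∘ toℕ {suc (suc n)}) ⟩
  ∑[ i ≤ n ] F (toℕ (inject₁ i)) + F (toℕ (fromℕ (suc n)))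
    ≡⟨ cong₂ _+_ (sum-cong-≗ {suc n} λ i → cong F (toℕ-inject₁ i)) (cong F (toℕ-fromℕ (suc n))) ⟩
  ∑[ i ≤ n ] F (toℕ i) + F (suc n)
    ∎

-- Binomial sums

-- `n C i` counts the ways to interleave a word of length `i` with one of length `n ∸ i`. Both
-- lengths are passed to `h`, so that either can be shifted on its own.
binomialSum : ℕ → (ℕ → ℕ → ℕ) → ℕ
binomialSum n h = ∑[ i ≤ n ] ((n C toℕ i) * h (toℕ i) (n ∸ toℕ i))

binomialSum-cong : ∀ n {g h : ℕ → ℕ → ℕ} → (∀ i j → g i j ≡ h i j) → binomialSum n g ≡ binomialSum n h
binomialSum-cong n g≗h = sum-cong-≗ {suc n} λ i → cong ((n C toℕ i) *_) (g≗h (toℕ i) (n ∸ toℕ i))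

-- Pascal's rule: the first position of an interleaving belongs either to the first word or to the
-- second.
binomialSum-suc : ∀ n (h : ℕ → ℕ → ℕ) →
  binomialSum (suc n) h ≡ binomialSum n (λ i j → h (suc i) j) + binomialSum n (λ i j → h i (suc j))
binomialSum-suc n h = begin
  F₀ + ∑[ i ≤ n ] ((suc n C suc (toℕ i)) * h (suc (toℕ i)) (n ∸ toℕ i))
    ≡⟨ cong (F₀ +_) (sum-cong-≗ {suc n} λ i → pascal (toℕ i) (h (suc (toℕ i)) (n ∸ toℕ i))) ⟩
  F₀ + ∑[ i ≤ n ] (G (toℕ i) + F (suc (toℕ i)))
    ≡⟨ cong (F₀ +_) (∑-distrib-+ (G ∘ toℕ {suc n}) (F ∘ suc ∘ toℕ)) ⟩
  F₀ + (∑[ i ≤ n ] G (toℕ i) + ∑[ i ≤ n ] F (suc (toℕ i)))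
    -- `F₀` is the missing term `F 0`, since `suc n C 0` and `n C 0` both compute to 1; moving it
    -- inward completes the sum of `F`.
    ≡⟨ exchange F₀ (∑[ i ≤ n ] G (toℕ i)) _ ⟩
  ∑[ i ≤ n ] G (toℕ i) + ∑[ i ≤ suc n ] F (toℕ i)
    ≡⟨ cong (∑[ i ≤ n ] G (toℕ i) +_) (sum-last-ℕ n F) ⟩
  ∑[ i ≤ n ] G (toℕ i) + (∑[ i ≤ n ] F (toℕ i) + F (suc n))
    ≡⟨ cong (λ z → ∑[ i ≤ n ] G (toℕ i) + z) F-extend ⟩
  ∑[ i ≤ n ] G (toℕ i) + binomialSum n (λ i j → h i (suc j))
    ∎
  where
  F G : ℕ → ℕ
  F i = (n C i) * h i (suc n ∸ i)
  G i = (n C i) * h (suc i) (n ∸ i)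

  F₀ = (suc n C 0) * h 0 (suc n)

  pascal : ∀ i x → (suc n C suc i) * x ≡ (n C i) * x + (n C suc i) * x
  pascal i x = trans (cong (_* x) (sym (nCk+nC[k+1]≡[n+1]C[k+1] n i))) (*-distribʳ-+ x (n C i) _)

  exchange : ∀ a b c → a + (b + c) ≡ b + (a + c)
  exchange = solve 3 (λ a b c → a :+ (b :+ c) := b :+ (a :+ c)) refl
    where open +-*-Solver

  F-extend : ∑[ i ≤ n ] F (toℕ i) + F (suc n) ≡ binomialSum n (λ i j → h i (suc j))
  F-extend = begin
    ∑[ i ≤ n ] F (toℕ i) + F (suc n)
      -- The subtraction is truncated, so `suc n ∸ i` becomes `suc (n ∸ i)` only by `i ≤ n`. The
      -- surplus last term vanishes because `n C suc n` is 0.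
      ≡⟨ cong₂ _+_ (sum-cong-≗ {suc n} λ i → cong (λ j → (n C toℕ i) * h (toℕ i) j) (+-∸-assoc 1 (toℕ≤pred[n] i)))
                   (cong (_* h (suc n) (n ∸ n)) (k>n⇒nCk≡0 (n<1+n n))) ⟩
    binomialSum n (λ i j → h i (suc j)) + 0
      ≡⟨ +-identityʳ _ ⟩
    binomialSum n (λ i j → h i (suc j))
      ∎

binomialSum-∑ : ∀ n k (h : Fin k → ℕ → ℕ → ℕ) →
  ∑[ a < k ] binomialSum n (h a) ≡ binomialSum n (λ i j → ∑[ a < k ] h a i j)
binomialSum-∑ n k h = begin
  ∑[ a < k ] ∑[ i ≤ n ] ((n C toℕ i) * h a (toℕ i) (n ∸ toℕ i))
    ≡⟨ ∑-comm {k} {suc n} (λ a i → (n C toℕ i) * h a (toℕ i) (n ∸ toℕ i)) ⟩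
  ∑[ i ≤ n ] ∑[ a < k ] ((n C toℕ i) * h a (toℕ i) (n ∸ toℕ i))
    ≡⟨ sum-cong-≗ {suc n} (λ i → *-distribˡ-sum (n C toℕ i) (λ a → h a (toℕ i) (n ∸ toℕ i))) ⟨
  binomialSum n (λ i j → ∑[ a < k ] h a i j)
    ∎

binomialSum-single : ∀ n (h : ℕ → ℕ → ℕ) (i : Fin (suc n)) → (∀ i′ j → i′ ≢ toℕ i → h i′ j ≡ 0) →
  binomialSum n h ≡ (n C toℕ i) * h (toℕ i) (n ∸ toℕ i)
binomialSum-single n h i zero-off-i =
  sum-single (λ i′ → (n C toℕ i′) * h (toℕ i′) (n ∸ toℕ i′)) i λ i′ i′≢i →
  trans (cong ((n C toℕ i′) *_) (zero-off-i (toℕ i′) _ (i′≢i ∘ toℕ-injective))) (*-zeroʳ (n C toℕ i′))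

-- Sums over words

-- Recursion on the first letter mirrors `words`, so peeling off a letter is definitional.
wordSum : ∀ k m → (Vec (Fin k) m → ℕ) → ℕ
wordSum k zero    g = g []
wordSum k (suc m) g = ∑[ a < k ] wordSum k m (g ∘ (a ∷_))

wordSum-cong : ∀ k m {g h : Vec (Fin k) m → ℕ} → g ≗ h → wordSum k m g ≡ wordSum k m h
wordSum-cong k zero    g≗h = g≗h []
wordSum-cong k (suc m) g≗h = sum-cong-≗ λ a → wordSum-cong k m (g≗h ∘ (a ∷_))

wordSum-zero : ∀ k m {g : Vec (Fin k) m → ℕ} → (∀ w → g w ≡ 0) → wordSum k m g ≡ 0
wordSum-zero k zero    g≗0 = g≗0 []
wordSum-zero k (suc m) g≗0 = sum-zero _ λ a → wordSum-zero k m (g≗0 ∘ (a ∷_))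

*-distribˡ-wordSum : ∀ k m c (g : Vec (Fin k) m → ℕ) → c * wordSum k m g ≡ wordSum k m (λ w → c * g w)
*-distribˡ-wordSum k zero    c g = refl
*-distribˡ-wordSum k (suc m) c g =
  trans (*-distribˡ-sum c (λ a → wordSum k m (g ∘ (a ∷_))))
        (sum-cong-≗ λ a → *-distribˡ-wordSum k m c (g ∘ (a ∷_)))

*-distribʳ-wordSum : ∀ k m c (g : Vec (Fin k) m → ℕ) → wordSum k m g * c ≡ wordSum k m (λ w → g w * c)
*-distribʳ-wordSum k m c g = begin
  wordSum k m g * c           ≡⟨ *-comm (wordSum k m g) c ⟩
  c * wordSum k m g           ≡⟨ *-distribˡ-wordSum k m c g ⟩
  wordSum k m (λ w → c * g w) ≡⟨ wordSum-cong k m (λ w → *-comm c (g w)) ⟩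
  wordSum k m (λ w → g w * c) ∎

wordSum-*-wordSum : ∀ k m l n (g : Vec (Fin k) m → ℕ) (h : Vec (Fin l) n → ℕ) →
  wordSum k m (λ u → wordSum l n λ v → g u * h v) ≡ wordSum k m g * wordSum l n h
wordSum-*-wordSum k m l n g h = begin
  wordSum k m (λ u → wordSum l n λ v → g u * h v) ≡⟨ wordSum-cong k m (λ u → *-distribˡ-wordSum l n (g u) h) ⟨
  wordSum k m (λ u → g u * wordSum l n h)         ≡⟨ *-distribʳ-wordSum k m (wordSum l n h) g ⟨
  wordSum k m g * wordSum l n h                   ∎

∑-wordSum-comm : ∀ l k m (g : Fin l → Vec (Fin k) m → ℕ) →
  ∑[ a < l ] wordSum k m (g a) ≡ wordSum k m (λ w → ∑[ a < l ] g a w)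
∑-wordSum-comm l k zero    g = refl
∑-wordSum-comm l k (suc m) g =
  trans (∑-comm (λ a b → wordSum k m (g a ∘ (b ∷_))))
        (sum-cong-≗ λ b → ∑-wordSum-comm l k m (λ a → g a ∘ (b ∷_)))

wordSum-++ : ∀ k m n (g : Vec (Fin k) (m + n) → ℕ) →
  wordSum k (m + n) g ≡ wordSum k m (λ x → wordSum k n λ y → g (x Vec.++ y))
wordSum-++ k zero    n g = refl
wordSum-++ k (suc m) n g = sum-cong-≗ λ a → wordSum-++ k m n (g ∘ (a ∷_))

-- Cardinalities of filtered lists as sums of indicators

length-filter-map : ∀ {A B : Set} {p} {P : Pred B p} (P? : Decidable P) (g : A → B) xs →
  length (filter P? (map g xs)) ≡ length (filter (P? ∘ g) xs)
length-filter-map P? g []       = refl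
length-filter-map P? g (x ∷ xs) with does (P? (g x))
... | true  = cong suc (length-filter-map P? g xs)
... | false = length-filter-map P? g xs

-- An arbitrary `t` keeps the induction going: the tail of `allFin` is a tabulation of `suc`, not
-- another `allFin`.
length-filter-cartesianProductWith :
  ∀ {A B D : Set} {p} {P : Pred D p} (P? : Decidable P) (_∙_ : A → B → D) {n} (t : Fin n → A) ys →
  length (filter P? (cartesianProductWith _∙_ (tabulate t) ys)) ≡
  ∑[ i < n ] length (filter (P? ∘ (t i ∙_)) ys)
length-filter-cartesianProductWith P? _∙_ {zero}  t ys = refl
length-filter-cartesianProductWith P? _∙_ {suc n} t ys = begin
  length (filter P? (map (t zero ∙_) ys ++ rest))
    ≡⟨ cong length (filter-++ P? (map (t zero ∙_) ys) rest) ⟩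
  length (filter P? (map (t zero ∙_) ys) ++ filter P? rest)
    ≡⟨ length-++ (filter P? (map (t zero ∙_) ys)) ⟩
  length (filter P? (map (t zero ∙_) ys)) + length (filter P? rest)
    ≡⟨ cong₂ _+_ (length-filter-map P? (t zero ∙_) ys)
                 (length-filter-cartesianProductWith P? _∙_ (t ∘ suc) ys) ⟩
  ∑[ i < suc n ] length (filter (P? ∘ (t i ∙_)) ys)
    ∎
  where rest = cartesianProductWith _∙_ (tabulate (t ∘ suc)) ys

length-filter-words : ∀ k m {p} {P : Pred (Vec (Fin k) m) p} (P? : Decidable P) →
  length (filter P? (words k m)) ≡ wordSum k m (⟦_⟧ ∘ P?)
length-filter-words k zero    P? with does (P? [])
... | true  = refl
... | false = refl
length-filter-words k (suc m) P? =
  trans (length-filter-cartesianProductWith P? _∷_ (λ a → a) (words k m))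
        (sum-cong-≗ λ a → length-filter-words k m (P? ∘ (a ∷_)))

-- Counting rearrangements

_↭?_ : ∀ {k} (xs ys : List (Fin k)) → Dec (xs ↭ ys)
_↭?_ = permutation? _≟ᶠ_

-- A multinomial coefficient when `m` is the length of `xs`. The two lengths are left independent
-- because the subwords of a word have no length fixed in advance.
rearrangements : ∀ k m → List (Fin k) → ℕ
rearrangements k m xs = wordSum k m λ w → ⟦ xs ↭? toList w ⟧

-- Permutations preserve length. This is what forces both halves of an abelian square to have left
-- subwords of the same length.
rearrangements-length : ∀ k m xs → m ≢ length xs → rearrangements k m xs ≡ 0
rearrangements-length k m xs m≢∣xs∣ = wordSum-zero k m λ w →
  ⟦⟧-false (xs ↭? toList w) λ p → m≢∣xs∣ (sym (trans (↭-length p) (length-toList w)))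

-- A word of length `n + n` has only one decomposition into halves of length `n`, so the existential
-- in `IsAbelianSquare` reduces to a condition on the two halves.
f≡∑rearrangements : ∀ k n → f k n ≡ wordSum k n (rearrangements k n ∘ toList)
f≡∑rearrangements k n = begin
  f k n
    ≡⟨ length-filter-words k (n + n) (isAbelianSquare? _≟ᶠ_ n) ⟩
  wordSum k (n + n) (⟦_⟧ ∘ isAbelianSquare? _≟ᶠ_ n)
    ≡⟨ wordSum-++ k n n _ ⟩
  wordSum k n (λ x → wordSum k n λ y → ⟦ isAbelianSquare? _≟ᶠ_ n (x Vec.++ y) ⟧)
    ≡⟨ wordSum-cong k n (λ x → wordSum-cong k n λ y →
         ⟦⟧-⇔ (halves x y) (isAbelianSquare? _≟ᶠ_ n (x Vec.++ y)) (toList x ↭? toList y)) ⟩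
  wordSum k n (rearrangements k n ∘ toList)
    ∎
  where
  halves : ∀ (x y : Vec (Fin k) n) → IsAbelianSquare n (x Vec.++ y) ⇔ (toList x ↭ toList y)
  halves x y = mk⇔ to λ p → x , y , refl , p
    where
    to : IsAbelianSquare n (x Vec.++ y) → toList x ↭ toList y
    to (x′ , y′ , eq , p) with refl , refl ← ++-injective x x′ eq = p

-- Splitting the alphabet

-- An induction in which a right element at the head is carried past the whole block of left
-- elements by `shift`.
↭-partition : ∀ {A B : Set} (zs : List (A ⊎ B)) →
              zs ↭ map inj₁ (mapMaybe isInj₁ zs) ++ map inj₂ (mapMaybe isInj₂ zs)
↭-partition []            = ↭-refl
↭-partition (inj₁ x ∷ zs) = ↭-prep (inj₁ x) (↭-partition zs)
↭-partition (inj₂ y ∷ zs) =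
  ↭-trans (↭-prep (inj₂ y) (↭-partition zs)) (↭-sym (shift (inj₂ y) (map inj₁ (mapMaybe isInj₁ zs)) _))

module _ (k₁ k₂ : ℕ) where

  lefts : List (Fin (k₁ + k₂)) → List (Fin k₁)
  lefts = mapMaybe isInj₁ ∘ map (splitAt k₁)

  rights : List (Fin (k₁ + k₂)) → List (Fin k₂)
  rights = mapMaybe isInj₂ ∘ map (splitAt k₁)

  map-join-splitAt : ∀ xs → map (join k₁ k₂) (map (splitAt k₁) xs) ≡ xs
  map-join-splitAt xs = trans (sym (map-∘ xs)) (trans (map-cong (join-splitAt k₁ k₂) xs) (map-id xs))

  -- Extracting a subword respects permutations. Conversely, each word is a permutation of its left
  -- subword followed by its right one, so permutations of the subwords can be concatenated and
  -- decoded by `join`.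
  ↭⇔lefts-rights : ∀ {xs ys} → (xs ↭ ys) ⇔ (lefts xs ↭ lefts ys × rights xs ↭ rights ys)
  ↭⇔lefts-rights {xs} {ys} = mk⇔
    (λ p → mapMaybe-↭ isInj₁ (map⁺ (splitAt k₁) p) , mapMaybe-↭ isInj₂ (map⁺ (splitAt k₁) p))
    (λ (p , q) → subst₂ _↭_ (map-join-splitAt xs) (map-join-splitAt ys) (map⁺ (join k₁ k₂)
      (↭-trans (↭-partition (map (splitAt k₁) xs))
        (↭-trans (++⁺ (map⁺ inj₁ p) (map⁺ inj₂ q)) (↭-sym (↭-partition (map (splitAt k₁) ys)))))))

  pairSum : (List (Fin k₁) → List (Fin k₂) → ℕ) → ℕ → ℕ → ℕ
  pairSum g i j = wordSum k₁ i λ u → wordSum k₂ j λ v → g (toList u) (toList v)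

  -- Induction on `n` by the first letter, which is absorbed into `g`; hence `g` has to vary in the
  -- induction. The recursion obtained is that of `binomialSum-suc`.
  wordSum-lefts-rights : ∀ n (g : List (Fin k₁) → List (Fin k₂) → ℕ) →
    wordSum (k₁ + k₂) n (λ w → g (lefts (toList w)) (rights (toList w))) ≡ binomialSum n (pairSum g)
  wordSum-lefts-rights zero    g = sym (trans (+-identityʳ _) (*-identityˡ _))
  wordSum-lefts-rights (suc n) g = begin
    ∑[ c < k₁ + k₂ ] fibre c
      ≡⟨ sum-splitAt k₁ fibre ⟩
    ∑[ a < k₁ ] fibre (a ↑ˡ k₂) + ∑[ b < k₂ ] fibre (k₁ ↑ʳ b)
      ≡⟨ cong₂ _+_ (sum-cong-≗ left-letter) (sum-cong-≗ right-letter) ⟩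
    ∑[ a < k₁ ] binomialSum n (pairSum (gˡ a)) + ∑[ b < k₂ ] binomialSum n (pairSum (gʳ b))
      ≡⟨ cong₂ _+_ (binomialSum-∑ n k₁ (pairSum ∘ gˡ)) (binomialSum-∑ n k₂ (pairSum ∘ gʳ)) ⟩
    binomialSum n (λ i j → pairSum g (suc i) j) + binomialSum n (λ i j → ∑[ b < k₂ ] pairSum (gʳ b) i j)
      -- Summing over a left first letter lengthens the left subword by definition. A right first
      -- letter must first be moved inside the sum over left subwords.
      ≡⟨ cong (binomialSum n (λ i j → pairSum g (suc i) j) +_) (binomialSum-cong n λ i j →
           ∑-wordSum-comm k₂ k₁ i λ b u → wordSum k₂ j λ v → gʳ b (toList u) (toList v)) ⟩
    binomialSum n (λ i j → pairSum g (suc i) j) + binomialSum n (λ i j → pairSum g i (suc j))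
      ≡⟨ binomialSum-suc n (pairSum g) ⟨
    binomialSum (suc n) (pairSum g)
      ∎
    where
    fibre : Fin (k₁ + k₂) → ℕ
    fibre c = wordSum (k₁ + k₂) n λ w → g (lefts (c ∷ toList w)) (rights (c ∷ toList w))

    gˡ : Fin k₁ → List (Fin k₁) → List (Fin k₂) → ℕ
    gˡ a xs ys = g (a ∷ xs) ys

    gʳ : Fin k₂ → List (Fin k₁) → List (Fin k₂) → ℕ
    gʳ b xs ys = g xs (b ∷ ys)

    left-letter : ∀ a → fibre (a ↑ˡ k₂) ≡ binomialSum n (pairSum (gˡ a))
    -- Once `splitAt` is evaluated at the head, `lefts` gains the letter and `rights` is unchanged,
    -- which leaves the induction hypothesis.
    left-letter a rewrite splitAt-↑ˡ k₁ a k₂ = wordSum-lefts-rights n (gˡ a)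

    right-letter : ∀ b → fibre (k₁ ↑ʳ b) ≡ binomialSum n (pairSum (gʳ b))
    right-letter b rewrite splitAt-↑ʳ k₁ k₂ b = wordSum-lefts-rights n (gʳ b)

  -- The indicator factors into one for left subwords and one for right subwords, so each term of
  -- the binomial sum separates into a product.
  rearrangements-lefts-rights : ∀ n xs → rearrangements (k₁ + k₂) n xs ≡
    binomialSum n (λ i j → rearrangements k₁ i (lefts xs) * rearrangements k₂ j (rights xs))
  rearrangements-lefts-rights n xs = begin
    wordSum (k₁ + k₂) n (λ w → ⟦ xs ↭? toList w ⟧)
      ≡⟨ wordSum-cong (k₁ + k₂) n (λ w → trans
           (⟦⟧-⇔ ↭⇔lefts-rights (xs ↭? toList w)
                 ((lefts xs ↭? lefts (toList w)) ×-dec (rights xs ↭? rights (toList w))))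
           (⟦⟧-× (lefts xs ↭? lefts (toList w)) (rights xs ↭? rights (toList w)))) ⟩
    wordSum (k₁ + k₂) n (λ w → ⟦ lefts xs ↭? lefts (toList w) ⟧ * ⟦ rights xs ↭? rights (toList w) ⟧)
      ≡⟨ wordSum-lefts-rights n (λ ys zs → ⟦ lefts xs ↭? ys ⟧ * ⟦ rights xs ↭? zs ⟧) ⟩
    binomialSum n (pairSum λ ys zs → ⟦ lefts xs ↭? ys ⟧ * ⟦ rights xs ↭? zs ⟧)
      ≡⟨ binomialSum-cong n (λ i j → wordSum-*-wordSum k₁ i k₂ j
           (λ u → ⟦ lefts xs ↭? toList u ⟧) (λ v → ⟦ rights xs ↭? toList v ⟧)) ⟩
    binomialSum n (λ i j → rearrangements k₁ i (lefts xs) * rearrangements k₂ j (rights xs))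
      ∎

mainTheorem3 : ∀ (k₁ k₂ n : ℕ) → 1 ≤ k₁ → 1 ≤ k₂ →
    f (k₁ + k₂) n ≡ ∑[ i ≤ n ] ((n C toℕ i) ^ 2 * f k₁ (toℕ i) * f k₂ (n ∸ toℕ i))
mainTheorem3 k₁ k₂ n _ _ = begin
  f (k₁ + k₂) n
    ≡⟨ f≡∑rearrangements (k₁ + k₂) n ⟩
  wordSum (k₁ + k₂) n (rearrangements (k₁ + k₂) n ∘ toList)
    -- The second half is split while the first is held fixed; the first half is split in the next
    -- step. Each splitting brings its own binomial sum.
    ≡⟨ wordSum-cong (k₁ + k₂) n (λ w → rearrangements-lefts-rights k₁ k₂ n (toList w)) ⟩
  wordSum (k₁ + k₂) n (λ w → pairs (lefts k₁ k₂ (toList w)) (rights k₁ k₂ (toList w)))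
    ≡⟨ wordSum-lefts-rights k₁ k₂ n pairs ⟩
  binomialSum n (pairSum k₁ k₂ pairs)
    ≡⟨ sum-cong-≗ {suc n} summand ⟩
  ∑[ i ≤ n ] ((n C toℕ i) ^ 2 * f k₁ (toℕ i) * f k₂ (n ∸ toℕ i))
    ∎
  where
  pairs : List (Fin k₁) → List (Fin k₂) → ℕ
  pairs xs ys = binomialSum n λ i j → rearrangements k₁ i xs * rearrangements k₂ j ys

  regroup : ∀ c a b → c * (c * (a * b)) ≡ c ^ 2 * a * b
  regroup = solve 3 (λ c a b → c :* (c :* (a :* b)) := c :^ 2 :* a :* b) refl
    where open +-*-Solver

  summand : ∀ (i : Fin (suc n)) →
    (n C toℕ i) * pairSum k₁ k₂ pairs (toℕ i) (n ∸ toℕ i) ≡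
    (n C toℕ i) ^ 2 * f k₁ (toℕ i) * f k₂ (n ∸ toℕ i)
  summand i′ = begin
    c * pairSum k₁ k₂ pairs i j
      -- Of the sum for the second half only the term at `i` survives: `toList u` has length `i` and
      -- no rearrangements of any other length. Its coefficient is the second factor `c`.
      ≡⟨ cong (c *_) (wordSum-cong k₁ i λ u → wordSum-cong k₂ j λ v →
           binomialSum-single n (λ m l → rearrangements k₁ m (toList u) * rearrangements k₂ l (toList v)) i′ λ m l m≢i →
             cong (_* rearrangements k₂ l (toList v)) (rearrangements-length k₁ m (toList u) (m≢i ∘ λ eq → trans eq (length-toList u)))) ⟩
    c * wordSum k₁ i (λ u → wordSum k₂ j λ v → c * (r₁ u * r₂ v))
      ≡⟨ cong (c *_) (wordSum-cong k₁ i λ u → *-distribˡ-wordSum k₂ j c (λ v → r₁ u * r₂ v)) ⟨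
    c * wordSum k₁ i (λ u → c * wordSum k₂ j λ v → r₁ u * r₂ v)
      ≡⟨ cong (c *_) (*-distribˡ-wordSum k₁ i c (λ u → wordSum k₂ j λ v → r₁ u * r₂ v)) ⟨
    c * (c * wordSum k₁ i (λ u → wordSum k₂ j λ v → r₁ u * r₂ v))
      ≡⟨ cong (λ z → c * (c * z)) (wordSum-*-wordSum k₁ i k₂ j r₁ r₂) ⟩
    c * (c * (wordSum k₁ i r₁ * wordSum k₂ j r₂))
      ≡⟨ regroup c (wordSum k₁ i r₁) (wordSum k₂ j r₂) ⟩
    c ^ 2 * wordSum k₁ i r₁ * wordSum k₂ j r₂
      ≡⟨ cong₂ (λ a b → c ^ 2 * a * b) (f≡∑rearrangements k₁ i) (f≡∑rearrangements k₂ j) ⟨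
    c ^ 2 * f k₁ i * f k₂ j
      ∎
    where
    i = toℕ i′
    j = n ∸ i
    c = n C i

    r₁ : Vec (Fin k₁) i → ℕ
    r₁ = rearrangements k₁ i ∘ toList

    r₂ : Vec (Fin k₂) j → ℕ
    r₂ = rearrangements k₂ j ∘ toList
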